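{- Let $S$ be a set of states and let $E$ be any one of the four encodings $E_{\mathrm{fwd}}$ (forward), $E_{\mathrm{bwd}}$ (backward), $E_{\mathrm{kind}}$ ($k$-induction), $E_{\mathrm{pdr}}$ (IC3/PDR, true case) defined in the context. Then for all $I \subseteq S$, $T \subseteq S\times S$, $P \subseteq S$ and $k \in \mathbb{N}$, $$E(I,T,P,k) \;\rightarrow\; \mathit{safety}(I,T,P).$$ (That is, the implication holds for each of the four encodings.)
   Context: $\mathbb{N}$ contains $0$. $S$ is a set of states; a state transition system is a pair $(I,T)$ with initial condition $I\subseteq S$ and transition relation $T\subseteq S\times S$; a property is a subset $P\subseteq S$. Subsets and relations are identified with predicates. $s_{[o..i]}$ denotes a sequence of states $s_o,\dots,s_i\in S$, and $\forall s_{[o..i]}$ quantifies over all such sequences. The ambient logic is classical. Paths: $\mathit{path}_T(s_{[o..i]})$ holds iff $T(s_j,s_{j+1})$ for all $o\le j<i$ (so it is true when $o=i$). Loop-free paths: $\mathit{loopF}_T(s_{[o..k]})$ holds iff $\mathit{path}_T(s_{[o..k]})$ and $s_i\neq s_j$ for all $o\le i<j\le k$. Safety: $\mathit{safety}(I,T,P) :\leftrightarrow \forall i\in\mathbb{N},\ \forall s_{[0..i]},\ I(s_0)\to \mathit{path}_T(s_{[0..i]})\to P(s_i)$. Bounded safety encoding: $E_{\mathrm{bnd}}(I,T,P,k) :\leftrightarrow \bigwedge_{0\le i\le k}\bigl(\forall s_{[0..i]},\ I(s_0)\to \mathit{path}_T(s_{[0..i]})\to P(s_i)\bigr)$. Forward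 encoding: $E_{\mathrm{fwd}}(I,T,P,k) :\leftrightarrow E_{\mathrm{bnd}}(I,T,P,k)\ \land\ \bigl(\forall s_{[0..k]},\ I(s_0)\to \neg\,\mathit{loopF}_T(s_{[0..k]})\bigr)$. Backward encoding: $E_{\mathrm{bwd}}(I,T,P,k) :\leftrightarrow E_{\mathrm{bnd}}(I,T,P,k)\ \land\ \bigl(\forall s_{[0..k]},\ \mathit{loopF}_T(s_{[0..k]})\to P(s_k)\bigr)$. $k$-induction encoding: $E_{\mathrm{kind}}(I,T,P,k) :\leftrightarrow E_{\mathrm{bnd}}(I,T,P,k)\ \land\ \bigl(\forall s_{[0..(k+1)]},\ \mathit{path}_T(s_{[0..(k+1)]})\to \bigwedge_{0\le i\le k}P(s_i)\to P(s_{k+1})\bigr)$. IC3/PDR encoding, true case: $E_{\mathrm{pdr}}(I,T,P,k)$ holds iff there exists an infinite sequence $R_0,R_1,R_2,\dots$ of subsets of $S$ such that (a) for all $i\in\mathbb{N}$ and $s\in S$, $I(s)\to R_i(s)$; (b) for all $i\in\mathbb{N}$ and $s\in S$, $R_i(s)\to P(s)$; (c) for all $i\in\mathbb{N}$ and $s\in S$, $R_i(s)\to R_{i+1}(s)$; (d) for all $i\le k$ and $s,s'\in S$, $R_i(s)\land T(s,s')\to R_{i+1}(s')$; (e) for all $s\in S$, $R_k(s)\leftrightarrow R_{k+1}(s)$. -}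

module Defs where

open import Level using (Level; _⊔_; suc)
open import Data.Fin.Base as Fin using (Fin; inject₁; fromℕ)
open import Data.Nat.Base as ℕ using (ℕ; _≤_)
open import Data.Product.Base using (_×_; Σ-syntax)
open import Data.Vec.Functional using (Vector)
open import Relation.Binary.Core using (Rel)
open import Relation.Binary.PropositionalEquality using (_≢_)
open import Relation.Nullary.Negation using (¬_)
open import Relation.Unary using (Pred; _⊆_; _≐_)

private
  variable
    a ℓ : Level
    S : Set a
    k : ℕ

-- Only sequences starting at index 0 are needed: s_{[0..k]} consists of k + 1
-- states and is a Vector S (1 + k), with s_k written s (fromℕ k).

path : Rel S ℓ → Vector S (ℕ.suc k) → Set ℓ
path {k = k} T s = ∀ (j : Fin k) → T (s (inject₁ j)) (s (Fin.suc j))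

loopF : {S : Set a} → Rel S ℓ → Vector S (ℕ.suc k) → Set (a ⊔ ℓ)
loopF T s = path T s × (∀ i j → i Fin.< j → s i ≢ s j)

module _ {S : Set a} (I : Pred S ℓ) (T : Rel S ℓ) (P : Pred S ℓ) where

  safety : Set (a ⊔ ℓ)
  safety = ∀ (i : ℕ) (s : Vector S (ℕ.suc i)) →
    I (s Fin.zero) → path T s → P (s (fromℕ i))

  E-bnd : ℕ → Set (a ⊔ ℓ)
  E-bnd k = ∀ (i : ℕ) → i ≤ k → ∀ (s : Vector S (ℕ.suc i)) →
    I (s Fin.zero) → path T s → P (s (fromℕ i))

  E-fwd : ℕ → Set (a ⊔ ℓ)
  E-fwd k = E-bnd k ×
    (∀ (s : Vector S (ℕ.suc k)) → I (s Fin.zero) → ¬ loopF T s)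

  E-bwd : ℕ → Set (a ⊔ ℓ)
  E-bwd k = E-bnd k ×
    (∀ (s : Vector S (ℕ.suc k)) → loopF T s → P (s (fromℕ k)))

  E-kind : ℕ → Set (a ⊔ ℓ)
  E-kind k = E-bnd k ×
    (∀ (s : Vector S (ℕ.suc (ℕ.suc k))) → path T s →
      (∀ (i : Fin (ℕ.suc k)) → P (s (inject₁ i))) → P (s (fromℕ (ℕ.suc k))))

  E-pdr : ℕ → Set (a ⊔ suc ℓ)
  E-pdr k = Σ[ R ∈ (ℕ → Pred S ℓ) ]
    (∀ i → I ⊆ R i) ×
    (∀ i → R i ⊆ P) ×
    (∀ i → R i ⊆ R (ℕ.suc i)) ×
    (∀ i → i ≤ k → ∀ s s′ → R i s × T s s′ → R (ℕ.suc i) s′) ×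
    (R k ≐ R (ℕ.suc k))

{-# OPTIONS --safe #-}

-- For the forward and backward encodings, excluded middle lets every path be
-- shortened to a loop-free path with the same endpoints: prepend a state x to a
-- loop-free path t, and if x already occurs in t, keep only the part of t
-- from that occurrence on. It then suffices to check safety on loop-free
-- paths; those of length at most k are covered by E-bnd, and a longer one has a
-- prefix and a suffix that are loop-free of length exactly k. A k-induction
-- step applies to longer paths through their last k + 2 states, and for
-- IC3/PDR the set R k is an inductive invariant.

module Submission where

open import Level using (Level; _⊔_; Lift; lift)
open import Axiom.ExcludedMiddle using (ExcludedMiddle)
open import Data.Fin.Base using (Fin; zero; suc; inject₁; fromℕ)
open import Data.Fin.Properties using (toℕ-inject₁)
open import Data.Fin.Relation.Unary.Top using (view; ‵fromℕ; ‵inject₁)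
open import Data.Nat.Base as ℕ using (ℕ; _≤′_; ≤′-refl; ≤′-step; z≤n; s<s; s<s⁻¹)
open import Data.Nat.Properties using (≤-total; ≤-<-connex; ≤⇒≤′; ≤-refl)
open import Data.Product.Base using (_×_; _,_; ∃)
open import Data.Sum.Base using (inj₁; inj₂)
open import Data.Vec.Functional using (Vector; _∷_; tail; init)
open import Function.Base using (_∘_)
open import Relation.Binary.Core using (Rel)
open import Relation.Binary.PropositionalEquality using (_≡_; _≢_; refl; sym; subst; subst₂)
open import Relation.Nullary.Decidable.Core using (yes; no)
open import Relation.Nullary.Negation using (¬_; contradiction)
open import Relation.Unary using (Pred)
open import Defs

private
  variable
    k m : ℕ

module _ {a ℓ} {S : Set a} (T : Rel S ℓ) where

  path-init : (s : Vector S (2 ℕ.+ k)) → path T s → path T (init s)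
  path-init s p = p ∘ inject₁

  path-tail : (s : Vector S (2 ℕ.+ k)) → path T s → path T (tail s)
  path-tail s p = p ∘ suc

  path-∷ : ∀ {x} (s : Vector S (ℕ.suc k)) → T x (s zero) → path T s → path T (x ∷ s)
  path-∷ s xTs p zero    = xTs
  path-∷ s xTs p (suc j) = p j

  loopF-init : (s : Vector S (2 ℕ.+ k)) → loopF T s → loopF T (init s)
  loopF-init s (p , distinct) = path-init s p , λ i j i<j →
    distinct (inject₁ i) (inject₁ j)
      -- Unlike for `suc`, the order has to be transported: `toℕ (inject₁ i)` equals `toℕ i` only
      -- propositionally.
      (subst₂ ℕ._<_ (sym (toℕ-inject₁ i)) (sym (toℕ-inject₁ j)) i<j)

  loopF-tail : (s : Vector S (2 ℕ.+ k)) → loopF T s → loopF T (tail s)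
  loopF-tail s (p , distinct) = path-tail s p , λ i j i<j →
    distinct (suc i) (suc j) (s<s i<j)

  loopF-∷ : ∀ {x} (s : Vector S (ℕ.suc k)) → T x (s zero) →
    (∀ j → x ≢ s j) → loopF T s → loopF T (x ∷ s)
  loopF-∷ s xTs x∉s (p , distinct) = path-∷ s xTs p , λ where
    zero    (suc j) _   → x∉s j
    (suc i) (suc j) i<j → distinct i j (s<s⁻¹ i<j)

  path-invariant : ∀ {q} {Q : Pred S q} → (∀ {x y} → Q x → T x y → Q y) →
    (s : Vector S (ℕ.suc k)) → path T s → Q (s zero) → Q (s (fromℕ k))
  path-invariant {k = ℕ.zero}  step s p q = q
  path-invariant {k = ℕ.suc k} step s p q =
    path-invariant step (tail s) (path-tail s p) (step q (p zero))

  -- The length is a field because cutting out loops changes it unpredictably; only the endpoints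
  -- survive.
  record LoopFreePath (x y : S) : Set (a ⊔ ℓ) where
    constructor loopFreePath
    field
      {len}    : ℕ
      states   : Vector S (ℕ.suc len)
      loopFree : loopF T states
      starts   : states zero ≡ x
      ends     : states (fromℕ len) ≡ y

  suffix : (s : Vector S (ℕ.suc k)) → loopF T s → ∀ j → LoopFreePath (s j) (s (fromℕ k))
  suffix               s lf zero    = loopFreePath s lf refl refl
  suffix {k = ℕ.suc k} s lf (suc j) = suffix (tail s) (loopF-tail s lf) j

  module _ (em : ExcludedMiddle (a ⊔ ℓ)) where

    prepend : ∀ {x y z} → T x y → LoopFreePath y z → LoopFreePath x z
    -- `Lift` raises the occurrence statement from level `a` to `a ⊔ ℓ`, where `em` decides it.
    prepend {x} xTy (loopFreePath t lf refl refl) with em {Lift ℓ (∃ λ j → t j ≡ x)}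
    ... | yes (lift (j , refl)) = suffix t lf j
    ... | no x∉t = loopFreePath (x ∷ t)
      (loopF-∷ t xTy (λ j x≡tⱼ → x∉t (lift (j , sym x≡tⱼ))) lf) refl refl

    shorten : (s : Vector S (ℕ.suc k)) → path T s → LoopFreePath (s zero) (s (fromℕ k))
    shorten {k = ℕ.zero}  s p = loopFreePath s (p , λ where zero zero ()) refl refl
    shorten {k = ℕ.suc k} s p = prepend (p zero) (shorten (tail s) (path-tail s p))

  module _ (I : Pred S ℓ) where

    -- `I` constrains the first state, so surplus states are dropped from the end.
    no-loopF-mono : k ≤′ m →
      (∀ (s : Vector S (ℕ.suc k)) → I (s zero) → ¬ loopF T s) →
      ∀ (s : Vector S (ℕ.suc m)) → I (s zero) → ¬ loopF T s
    no-loopF-mono ≤′-refl       none s i lf = none s i lf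
    no-loopF-mono (≤′-step k≤m) none s i lf =
      no-loopF-mono k≤m none (init s) i (loopF-init s lf)

  module _ (P : Pred S ℓ) where

    -- `P` is asked of the last state, so surplus states are dropped from the front.
    loopF-ends-mono : k ≤′ m →
      (∀ (s : Vector S (ℕ.suc k)) → loopF T s → P (s (fromℕ k))) →
      ∀ (s : Vector S (ℕ.suc m)) → loopF T s → P (s (fromℕ m))
    loopF-ends-mono ≤′-refl       ends s lf = ends s lf
    loopF-ends-mono (≤′-step k≤m) ends s lf =
      loopF-ends-mono k≤m ends (tail s) (loopF-tail s lf)

    induction-step-mono : k ≤′ m →
      (∀ (s : Vector S (2 ℕ.+ k)) → path T s →
        (∀ i → P (s (inject₁ i))) → P (s (fromℕ (ℕ.suc k)))) →
      ∀ (s : Vector S (2 ℕ.+ m)) → path T s →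
        (∀ i → P (s (inject₁ i))) → P (s (fromℕ (ℕ.suc m)))
    induction-step-mono ≤′-refl       step s p safe = step s p safe
    induction-step-mono (≤′-step k≤m) step s p safe =
      induction-step-mono k≤m step (tail s) (path-tail s p) (safe ∘ suc)

  module _ (I P : Pred S ℓ) where

    loopF-safety : ExcludedMiddle (a ⊔ ℓ) →
      (∀ m (t : Vector S (ℕ.suc m)) → I (t zero) → loopF T t → P (t (fromℕ m))) →
      safety I T P
    loopF-safety em safe i s init-s p with shorten em s p
    ... | loopFreePath {m} t lf starts ends =
      subst P ends (safe m t (subst I (sym starts) init-s) lf)

    fwd-sound : ExcludedMiddle (a ⊔ ℓ) → E-fwd I T P k → safety I T P
    fwd-sound {k = k} em (bnd , none) = loopF-safety em safe
      where
      safe : ∀ m (t : Vector S (ℕ.suc m)) → I (t zero) → loopF T t → P (t (fromℕ m))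
      safe m t i lf@(p , _) with ≤-total m k
      ... | inj₁ m≤k = bnd m m≤k t i p
      -- No loop-free path from `I` is this long, so the case is vacuous.
      ... | inj₂ k≤m = contradiction lf (no-loopF-mono I (≤⇒≤′ k≤m) none t i)

    bwd-sound : ExcludedMiddle (a ⊔ ℓ) → E-bwd I T P k → safety I T P
    bwd-sound {k = k} em (bnd , ends) = loopF-safety em safe
      where
      safe : ∀ m (t : Vector S (ℕ.suc m)) → I (t zero) → loopF T t → P (t (fromℕ m))
      safe m t i lf@(p , _) with ≤-total m k
      ... | inj₁ m≤k = bnd m m≤k t i p
      ... | inj₂ k≤m = loopF-ends-mono P (≤⇒≤′ k≤m) ends t lf

    kind-sound : E-kind I T P k → safety I T P
    kind-sound {k = k} (bnd , step) i s init-s p = all-safe i s init-s p (fromℕ i)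
      where
      -- Covering every position strengthens the recursion: on `init s` it supplies `P` at all
      -- earlier states, as the induction step demands.
      all-safe : ∀ m (s : Vector S (ℕ.suc m)) → I (s zero) → path T s → ∀ j → P (s j)
      all-safe ℕ.zero    s i p zero = bnd 0 z≤n s i p
      all-safe (ℕ.suc m) s i p j with view j
      ... | ‵inject₁ j′ = all-safe m (init s) i (path-init s p) j′
      -- The path has `m + 2` states, enough for a window of `k + 2` exactly when `k ≤ m`. Otherwise
      -- `m<k` unfolds to `suc m ≤ k`, the bound required by `bnd`.
      ... | ‵fromℕ with ≤-<-connex k m
      ...   | inj₁ k≤m = induction-step-mono P (≤⇒≤′ k≤m) step s p
                           (all-safe m (init s) i (path-init s p))
      ...   | inj₂ m<k = bnd (ℕ.suc m) m<k s i p

    pdr-sound : E-pdr I T P k → safety I T P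
    pdr-sound {k = k} (R , I⊆R , R⊆P , _ , step , _ , Rₖ₊₁⊆Rₖ) i s init-s p =
      -- `step` at its last admissible index `k` leads from `R k` into `R (suc k)`, and `Rₖ₊₁⊆Rₖ`
      -- leads back.
      R⊆P k (path-invariant {Q = R k} (λ Rₖx xTy → Rₖ₊₁⊆Rₖ (step k ≤-refl _ _ (Rₖx , xTy)))
               s p (I⊆R k init-s))

theorem1 : ∀ {a ℓ : Level} → ExcludedMiddle (a ⊔ ℓ) → (S : Set a) →
    (∀ (I : Pred S ℓ) (T : Rel S ℓ) (P : Pred S ℓ) (k : ℕ) → E-fwd I T P k → safety I T P) ×
    (∀ (I : Pred S ℓ) (T : Rel S ℓ) (P : Pred S ℓ) (k : ℕ) → E-bwd I T P k → safety I T P) ×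
    (∀ (I : Pred S ℓ) (T : Rel S ℓ) (P : Pred S ℓ) (k : ℕ) → E-kind I T P k → safety I T P) ×
    (∀ (I : Pred S ℓ) (T : Rel S ℓ) (P : Pred S ℓ) (k : ℕ) → E-pdr I T P k → safety I T P)
theorem1 em S =
  (λ I T P k → fwd-sound T I P em) ,
  (λ I T P k → bwd-sound T I P em) ,
  (λ I T P k → kind-sound T I P) ,
  (λ I T P k → pdr-sound T I P)
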